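{- Let $T:\mathbf{Set}\to\mathbf{Set}$ be a functor and $\Lambda$ a strongly expressive set of monotone singleton-preserving predicate liftings for $T$. Then for all $T$-coalgebras $(X,\xi)$, $(Y,\zeta)$ and states $x\in X$, $y\in Y$: $x$ and $y$ are $\Lambda$-bisimilar if and only if they are behaviourally equivalent.
   Context: An $n$-ary predicate lifting for $T$ is a family $\lambda_X:(\mathcal{P}X)^n\to\mathcal{P}(TX)$ natural w.r.t. preimages ($\lambda_X(f^{ -1}[A_1],\dots)=(Tf)^{ -1}[\lambda_Y(A_1,\dots)]$); monotone if monotone in every argument; singleton-preserving if $|\lambda_X(\{x_1\},\dots,\{x_n\})|=1$ always. $\Lambda$ is strongly expressive if for every set $X$ and $t\in TX$ there are $\lambda/n\in\Lambda$ and $x_i\in X$ with $\{t\}=\lambda_X(\{x_1\},\dots,\{x_n\})$. A $T$-coalgebra is a pair $(X,\xi)$ with $\xi:X\to TX$; a morphism $h:(X,\xi)\to(Y,\zeta)$ is a map with $Th\circ\xi=\zeta\circ h$. States $x\in X$, $y\in Y$ are behaviourally equivalent if there are a coalgebra $(Z,\theta)$ and morphisms $f:(X,\xi)\to(Z,\theta)$, $g:(Y,\zeta)\to(Z,\theta)$ with $f(x)=g(y)$. For $S\subseteq X\times Y$ and $A\subseteq X$, $S[A]=\{y\mid\exists a\in A.\,a\,S\,y\}$. A $\Lambda$-simulation is a relation $S\subseteq X\times Y$ such that for all $\lambda/n\in\Lambda$, $X_1,\dots,X_n\subseteq X$ and $x\,S\,y$: $\xi(x)\in\lambda_X(X_1,\dots,X_n)$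 implies $\zeta(y)\in\lambda_Y(S[X_1],\dots,S[X_n])$. A $\Lambda$-bisimulation is a $\Lambda$-simulation $S$ whose converse is also a $\Lambda$-simulation; $x,y$ are $\Lambda$-bisimilar if some $\Lambda$-bisimulation relates them. -}

module Defs where

-- "Set" is read as the category of setoids: its objects are sets with an
-- equality relation, its morphisms are equality-preserving functions.
-- Accordingly, equality of elements of a set is the setoid equality `_≈_`,
-- equality of functions is pointwise, equality of subsets is extensional, and
-- subsets and relations are closed under equality of elements.

open import Data.Fin.Base using (Fin)
open import Data.Nat.Base using (ℕ)
open import Data.Product using (Σ; ∃; ∃!; _×_; _,_; swap)
open import Data.Product.Relation.Binary.Pointwise.NonDependent using (_×ₛ_)
open import Data.Vec.Functional using (Vector; updateAt)
open import Function.Base using (_∘_; const)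
open import Function.Bundles using (Func; _⟶ₛ_; _⟨$⟩_)
import Function.Construct.Composition as Composition
import Function.Construct.Identity as Identity
open import Level using (Level; _⊔_; suc)
open import Relation.Binary.Bundles using (Setoid)
open import Relation.Binary.Definitions using (_Respects_)
open import Relation.Unary using (Pred; _∈_; _⊆_; _≐_)

open Setoid using (Carrier)

infix 4 _∈ₛ_ _⊆ₛ_ _≐ₛ_

record Subset {ℓ : Level} (X : Setoid ℓ ℓ) : Set (suc ℓ) where
  field
    pred     : Pred (Carrier X) ℓ
    respects : pred Respects (Setoid._≈_ X)

open Subset

_∈ₛ_ : {ℓ : Level} {X : Setoid ℓ ℓ} → Carrier X → Subset X → Set ℓ
x ∈ₛ A = x ∈ pred A

_⊆ₛ_ : {ℓ : Level} {X : Setoid ℓ ℓ} → Subset X → Subset X → Set ℓ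
A ⊆ₛ B = pred A ⊆ pred B

_≐ₛ_ : {ℓ : Level} {X : Setoid ℓ ℓ} → Subset X → Subset X → Set ℓ
A ≐ₛ B = pred A ≐ pred B

singleton : {ℓ : Level} (X : Setoid ℓ ℓ) → Carrier X → Subset X
singleton X x = record
  { pred     = λ y → x ≈ y
  ; respects = λ y≈z x≈y → trans x≈y y≈z
  } where open Setoid X

preimage : {ℓ : Level} {X Y : Setoid ℓ ℓ} → X ⟶ₛ Y → Subset Y → Subset X
preimage f A = record
  { pred     = λ x → (f ⟨$⟩ x) ∈ₛ A
  ; respects = λ x≈y → respects A (Func.cong f x≈y)
  }

-- |A| = 1
HasOneElement : {ℓ : Level} {X : Setoid ℓ ℓ} → Subset X → Set ℓ
HasOneElement {X = X} A = ∃! (Setoid._≈_ X) (λ x → x ∈ₛ A)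

Relation : {ℓ : Level} → Setoid ℓ ℓ → Setoid ℓ ℓ → Set (suc ℓ)
Relation X Y = Subset (X ×ₛ Y)

converse : {ℓ : Level} {X Y : Setoid ℓ ℓ} → Relation X Y → Relation Y X
converse S = record
  { pred     = λ p → swap p ∈ₛ S
  ; respects = λ p≈q → respects S (swap p≈q)
  }

-- S[A]
image : {ℓ : Level} {X Y : Setoid ℓ ℓ} → Relation X Y → Subset X → Subset Y
image {X = X} S A = record
  { pred     = λ y → ∃ λ a → a ∈ₛ A × (a , y) ∈ₛ S
  ; respects = λ { y≈z (a , a∈A , aSy) →
                   a , a∈A , respects S (Setoid.refl X , y≈z) aSy }
  }

record SetFunctor (ℓ : Level) : Set (suc ℓ) where
  field
    obj : Setoid ℓ ℓ → Setoid ℓ ℓ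
    map : {X Y : Setoid ℓ ℓ} → X ⟶ₛ Y → obj X ⟶ₛ obj Y

    map-cong : {X Y : Setoid ℓ ℓ} (f g : X ⟶ₛ Y) →
               (∀ x → Setoid._≈_ Y (f ⟨$⟩ x) (g ⟨$⟩ x)) →
               ∀ t → Setoid._≈_ (obj Y) (map f ⟨$⟩ t) (map g ⟨$⟩ t)
    map-id   : (X : Setoid ℓ ℓ) →
               ∀ t → Setoid._≈_ (obj X) (map (Identity.function X) ⟨$⟩ t) t
    -- `Composition.function f g` is "first f, then g".
    map-∘    : {X Y Z : Setoid ℓ ℓ} (f : X ⟶ₛ Y) (g : Y ⟶ₛ Z) →
               ∀ t → Setoid._≈_ (obj Z)
                       (map (Composition.function f g) ⟨$⟩ t)
                       (map g ⟨$⟩ (map f ⟨$⟩ t))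

module _ {ℓ : Level} (T : SetFunctor ℓ) where

  open SetFunctor T

  record PredicateLifting (n : ℕ) : Set (suc ℓ) where
    field
      lift      : (X : Setoid ℓ ℓ) → Vector (Subset X) n → Subset (obj X)
      lift-cong : (X : Setoid ℓ ℓ) (As Bs : Vector (Subset X) n) →
                  (∀ i → As i ≐ₛ Bs i) → lift X As ≐ₛ lift X Bs
      natural   : {X Y : Setoid ℓ ℓ} (f : X ⟶ₛ Y) (As : Vector (Subset Y) n) →
                  lift X (preimage f ∘ As) ≐ₛ preimage (map f) (lift Y As)

  open PredicateLifting

  Monotone : {n : ℕ} → PredicateLifting n → Set (suc ℓ)
  Monotone {n} l =
    (X : Setoid ℓ ℓ) (As : Vector (Subset X) n) (i : Fin n) (B : Subset X) →
    As i ⊆ₛ B → lift l X As ⊆ₛ lift l X (updateAt As i (const B))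

  SingletonPreserving : {n : ℕ} → PredicateLifting n → Set (suc ℓ)
  SingletonPreserving {n} l =
    (X : Setoid ℓ ℓ) (xs : Vector (Carrier X) n) →
    HasOneElement (lift l X (singleton X ∘ xs))

  -- A set Λ of predicate liftings of finite arities, as an indexed family.
  record LiftingSet (i : Level) : Set (suc (i ⊔ ℓ)) where
    field
      Index   : Set i
      arity   : Index → ℕ
      lifting : (k : Index) → PredicateLifting (arity k)

  record Coalgebra : Set (suc ℓ) where
    field
      states     : Setoid ℓ ℓ
      transition : states ⟶ₛ obj states

  open Coalgebra

  State : Coalgebra → Set ℓ
  State C = Carrier (states C)

  record Morphism (C D : Coalgebra) : Set ℓ where
    field
      fun      : states C ⟶ₛ states D
      commutes : ∀ x → Setoid._≈_ (obj (states D))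
                         (map fun ⟨$⟩ (transition C ⟨$⟩ x))
                         (transition D ⟨$⟩ (fun ⟨$⟩ x))

  open Morphism

  BehaviourallyEquivalent : (C D : Coalgebra) → State C → State D → Set (suc ℓ)
  BehaviourallyEquivalent C D x y =
    Σ Coalgebra λ E → Σ (Morphism C E) λ f → Σ (Morphism D E) λ g →
    Setoid._≈_ (states E) (fun f ⟨$⟩ x) (fun g ⟨$⟩ y)

  module _ {i : Level} (Λ : LiftingSet i) where

    open LiftingSet Λ

    StronglyExpressive : Set (i ⊔ suc ℓ)
    StronglyExpressive =
      (X : Setoid ℓ ℓ) (t : Carrier (obj X)) →
      Σ Index λ k → Σ (Vector (Carrier X) (arity k)) λ xs →
      singleton (obj X) t ≐ₛ lift (lifting k) X (singleton X ∘ xs)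

    IsSimulation : (C D : Coalgebra) → Relation (states C) (states D) →
                   Set (i ⊔ suc ℓ)
    IsSimulation C D S =
      (k : Index) (As : Vector (Subset (states C)) (arity k)) →
      ∀ x y → (x , y) ∈ₛ S →
      (transition C ⟨$⟩ x) ∈ₛ lift (lifting k) (states C) As →
      (transition D ⟨$⟩ y) ∈ₛ lift (lifting k) (states D) (image S ∘ As)

    IsBisimulation : (C D : Coalgebra) → Relation (states C) (states D) →
                     Set (i ⊔ suc ℓ)
    IsBisimulation C D S = IsSimulation C D S × IsSimulation D C (converse S)

    Bisimilar : (C D : Coalgebra) → State C → State D → Set (i ⊔ suc ℓ)
    Bisimilar C D x y =
      Σ (Relation (states C) (states D)) λ S →
      IsBisimulation C D S × (x , y) ∈ₛ S

{-# OPTIONS --safe #-}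

-- For a cospan of morphisms f, g, naturality carries membership in a lifting
-- along f and back along g, so { (x , y) | f x ≈ g y } is a bisimulation.
-- Conversely, a simulation S makes X ⊎ Y modulo the equivalence generated by S
-- a coalgebra: if x S y and { T inj₁ (ξ x) } = λ ({z₁} , … , {zₙ}), then the
-- simulation condition puts T inj₂ (ζ y) into the same singleton.

module Submission where

open import Defs
open import Data.Fin.Base using (zero; suc)
open import Data.Nat.Base using (ℕ; zero; suc)
open import Data.Product using (_,_; proj₁; proj₂)
open import Data.Sum.Base using (_⊎_; inj₁; inj₂; [_,_])
open import Data.Vec.Functional using (Vector; updateAt; _∷_; head; tail)
open import Function.Base using (_∘_; id; const)
open import Function.Bundles using (Func; _⟶ₛ_; _⟨$⟩_; _⇔_; mk⇔)
open import Level using (Level)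
open import Relation.Binary.Bundles using (Setoid)
open import Relation.Binary.Core using (Rel)
import Relation.Binary.Construct.Closure.Equivalence as EqClosure
open import Relation.Binary.Definitions using (_Respects_)
open import Relation.Binary.PropositionalEquality using (refl; sym; subst; _≗_)
open import Relation.Unary using (Pred)

open Setoid using (Carrier)

module _ {a r p : Level} {A : Set a} (_≲_ : Rel A r) where

  -- Induction on the length: replace the head first, then recur on the tails with the new head held
  -- fixed. Functional vectors built in different ways agree only pointwise, so `P` has to respect
  -- `_≗_` to pass between `updateAt` and `_∷_`.
  coordinatewise⇒jointly-monotone :
    {n : ℕ} (P : Pred (Vector A n) p) → P Respects _≗_ →
    (∀ as i b → as i ≲ b → P as → P (updateAt as i (const b))) →
    ∀ as bs → (∀ i → as i ≲ bs i) → P as → P bs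
  coordinatewise⇒jointly-monotone {zero} P resp step as bs as≲bs Pas =
    resp (λ ()) Pas
  coordinatewise⇒jointly-monotone {suc n} P resp step as bs as≲bs Pas =
    resp (λ { zero → refl ; (suc _) → refl })
      (coordinatewise⇒jointly-monotone
        (λ vs → P (head bs ∷ vs))
        (λ vs≗ws → resp λ { zero → refl ; (suc j) → vs≗ws j })
        (λ vs i b vᵢ≲b Pvs →
          resp (λ { zero → refl ; (suc _) → refl })
            (step (head bs ∷ vs) (suc i) b vᵢ≲b Pvs))
        (tail as) (tail bs) (as≲bs ∘ suc)
        (resp (λ { zero → refl ; (suc _) → refl })
          (step as zero (head bs) (as≲bs zero) Pas)))

-- With this encoding, `image (graph f) A` is the direct image of `A`, already closed under the
-- equality of `Y`.
graph : {ℓ : Level} {X Y : Setoid ℓ ℓ} → X ⟶ₛ Y → Relation X Y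
graph {X = X} {Y} f = record
  { pred     = λ (x , y) → f ⟨$⟩ x ≈ y
  ; respects = λ (x≈x′ , y≈y′) fx≈y →
      trans (Func.cong f (Setoid.sym X x≈x′)) (trans fx≈y y≈y′)
  } where open Setoid Y

pullback : {ℓ : Level} {X Y Z : Setoid ℓ ℓ} → X ⟶ₛ Z → Y ⟶ₛ Z → Relation X Y
pullback {X = X} {Y} {Z} f g = record
  { pred     = λ (x , y) → f ⟨$⟩ x ≈ g ⟨$⟩ y
  ; respects = λ (x≈x′ , y≈y′) fx≈gy →
      trans (Func.cong f (Setoid.sym X x≈x′)) (trans fx≈gy (Func.cong g y≈y′))
  } where open Setoid Z

module Gluing {ℓ : Level} {X Y : Setoid ℓ ℓ} (S : Relation X Y) where

  data Glue : Rel (Carrier X ⊎ Carrier Y) ℓ where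
    left  : ∀ {x x′} → Setoid._≈_ X x x′ → Glue (inj₁ x) (inj₁ x′)
    right : ∀ {y y′} → Setoid._≈_ Y y y′ → Glue (inj₂ y) (inj₂ y′)
    cross : ∀ {x y} → (x , y) ∈ₛ S → Glue (inj₁ x) (inj₂ y)

  -- The pushout of the two projections from `S` to `X` and `Y`. The carrier stays the disjoint
  -- union; all identification happens in the equality.
  glued : Setoid ℓ ℓ
  glued = EqClosure.setoid Glue

  inl : X ⟶ₛ glued
  inl = record { to = inj₁ ; cong = λ e → EqClosure.return (left e) }

  inr : Y ⟶ₛ glued
  inr = record { to = inj₂ ; cong = λ e → EqClosure.return (right e) }

  inl≈inr : ∀ {x y} → (x , y) ∈ₛ S → Setoid._≈_ glued (inj₁ x) (inj₂ y)
  inl≈inr xSy = EqClosure.return (cross xSy)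

  -- The kernel of `h` is an equivalence relation, so it contains the closure of `Glue` as soon as
  -- it contains each generator.
  copair : {W : Setoid ℓ ℓ} (f : X ⟶ₛ W) (g : Y ⟶ₛ W) →
           (∀ x y → (x , y) ∈ₛ S → Setoid._≈_ W (f ⟨$⟩ x) (g ⟨$⟩ y)) →
           glued ⟶ₛ W
  copair {W} f g f≈g = record
    { to   = h
    ; cong = EqClosure.gfold (Setoid.isEquivalence W) h λ where
        (left e)    → Func.cong f e
        (right e)   → Func.cong g e
        (cross xSy) → f≈g _ _ xSy
    } where h = [ f ⟨$⟩_ , g ⟨$⟩_ ]

module _ {ℓ : Level} (T : SetFunctor ℓ) where

  open SetFunctor T
  open Coalgebra
  open Morphism
  open PredicateLifting
  open Subset

  lift-mono : {n : ℕ} (l : PredicateLifting T n) → Monotone T l →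
              (X : Setoid ℓ ℓ) (As Bs : Vector (Subset X) n) →
              (∀ i → As i ⊆ₛ Bs i) → lift l X As ⊆ₛ lift l X Bs
  lift-mono l mono X As Bs As⊆Bs {t} =
    coordinatewise⇒jointly-monotone _⊆ₛ_
      (λ Vs → t ∈ₛ lift l X Vs)
      -- Propositionally equal subsets have the same elements, which is what `lift-cong` asks for.
      (λ Vs≗Ws → proj₁ (lift-cong l X _ _ λ i →
        (λ {z} → subst (z ∈ₛ_) (Vs≗Ws i)) ,
        (λ {z} → subst (z ∈ₛ_) (sym (Vs≗Ws i)))))
      (λ Vs i B Vᵢ⊆B → mono X Vs i B Vᵢ⊆B)
      As Bs As⊆Bs

  module _ {i : Level} (Λ : LiftingSet T i) where

    open LiftingSet Λ

    module _ (mono : ∀ k → Monotone T (lifting k)) where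

      -- Each set A is sent to its direct image f[A] in `E`. The proof rests on A ⊆ f⁻¹[f[A]] and
      -- g⁻¹[f[A]] ⊆ S[A], joined by naturality at `f` and at `g`. Taking `S` up to `_≐ₛ_` lets the
      -- lemma also cover the converse of a pullback.
      cospan-simulation :
        {C D E : Coalgebra T} (f : Morphism T C E) (g : Morphism T D E)
        (S : Relation (states C) (states D)) →
        S ≐ₛ pullback (fun f) (fun g) →
        IsSimulation T Λ C D S
      cospan-simulation {C} {D} {E} f g S (S⊆ , ⊆S) k As x y xSy ξx∈ =
        lift-mono l (mono k) (states D) (preimage (fun g) ∘ fAs) (image S ∘ As)
          -- g⁻¹[f[A]] ⊆ S[A], because `S` contains every pair that the cospan identifies.
          (λ _ (a , a∈A , fa≈gy) → a , a∈A , ⊆S fa≈gy)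
          (proj₂ (natural l (fun g) fAs)
            (respects (lift l (states E) fAs) Tfξx≈Tgζy
              (proj₁ (natural l (fun f) fAs)
                (lift-mono l (mono k) (states C) As (preimage (fun f) ∘ fAs)
                  (λ _ {a} a∈A → a , a∈A , Setoid.refl (states E))
                  ξx∈))))
        where
        l = lifting k

        fAs : Vector (Subset (states E)) (arity k)
        fAs = image (graph (fun f)) ∘ As

        Tfξx≈Tgζy : Setoid._≈_ (obj (states E))
                      (map (fun f) ⟨$⟩ (transition C ⟨$⟩ x))
                      (map (fun g) ⟨$⟩ (transition D ⟨$⟩ y))
        Tfξx≈Tgζy = trans (commutes f x)
                      (trans (Func.cong (transition E) (S⊆ xSy))
                        (Setoid.sym (obj (states E)) (commutes g y)))
          where open Setoid (obj (states E)) using (trans)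

      behaviourallyEquivalent⇒bisimilar :
        (C D : Coalgebra T) (x : State T C) (y : State T D) →
        BehaviourallyEquivalent T C D x y → Bisimilar T Λ C D x y
      behaviourallyEquivalent⇒bisimilar C D x y (E , f , g , fx≈gy) =
        S ,
        ( cospan-simulation f g S (id , id)
        -- `converse S` and `pullback (fun g) (fun f)` differ by the orientation of one equation in
        -- `E`.
        , cospan-simulation g f (converse S) (Esym , Esym) ) ,
        fx≈gy
        where
        S = pullback (fun f) (fun g)
        Esym : ∀ {u v} → Setoid._≈_ (states E) u v → Setoid._≈_ (states E) v u
        Esym = Setoid.sym (states E)

      module _ (expressive : StronglyExpressive T Λ) {C D : Coalgebra T}
               (S : Relation (states C) (states D))
               (sim : IsSimulation T Λ C D S) where

        open Gluing S

        -- This is the compatibility on `cross` generators that `copair` requires of the glued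
        -- transition map. Expressiveness is applied at `glued` rather than at `X`, so that the
        -- singletons can be pulled back along both injections.
        simulation-glues-transitions :
          ∀ x y → (x , y) ∈ₛ S →
          Setoid._≈_ (obj glued)
            (map inl ⟨$⟩ (transition C ⟨$⟩ x))
            (map inr ⟨$⟩ (transition D ⟨$⟩ y))
        simulation-glues-transitions x y xSy
          with expressive glued (map inl ⟨$⟩ (transition C ⟨$⟩ x))
        ... | k , zs , t⊆λzs , λzs⊆t =
          λzs⊆t (proj₁ (natural l inr Zs)
            (lift-mono l (mono k) (states D)
              (image S ∘ preimage inl ∘ Zs) (preimage inr ∘ Zs)
              -- S[inl⁻¹{z}] ⊆ inr⁻¹{z}, since related states have become equal in `glued`.
              (λ _ (_ , z≈a , aSb) → Setoid.trans glued z≈a (inl≈inr aSb))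
              (sim k (preimage inl ∘ Zs) x y xSy
                (proj₂ (natural l inl Zs) (t⊆λzs (Setoid.refl (obj glued)))))))
          where
          l = lifting k
          Zs = singleton glued ∘ zs

        gluedCoalgebra : Coalgebra T
        gluedCoalgebra = record
          { states     = glued
          ; transition = copair
              (record { to   = λ x → map inl ⟨$⟩ (transition C ⟨$⟩ x)
                      ; cong = Func.cong (map inl) ∘ Func.cong (transition C) })
              (record { to   = λ y → map inr ⟨$⟩ (transition D ⟨$⟩ y)
                      ; cong = Func.cong (map inr) ∘ Func.cong (transition D) })
              simulation-glues-transitions
          }

        simulation⇒behaviourallyEquivalent :
          ∀ x y → (x , y) ∈ₛ S → BehaviourallyEquivalent T C D x y
        simulation⇒behaviourallyEquivalent x y xSy =
          gluedCoalgebra ,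
          -- Both morphism squares hold by computation: `copair` reduces on `inj₁` and `inj₂`.
          record { fun = inl ; commutes = λ _ → Setoid.refl (obj glued) } ,
          record { fun = inr ; commutes = λ _ → Setoid.refl (obj glued) } ,
          inl≈inr xSy

mainTheorem6 : {ℓ i : Level} (T : SetFunctor ℓ) (Λ : LiftingSet T i) →
    StronglyExpressive T Λ →
    (∀ k → Monotone T (LiftingSet.lifting Λ k)) →
    (∀ k → SingletonPreserving T (LiftingSet.lifting Λ k)) →
    (C D : Coalgebra T) (x : State T C) (y : State T D) →
    Bisimilar T Λ C D x y ⇔ BehaviourallyEquivalent T C D x y
mainTheorem6 T Λ expressive mono _ C D x y = mk⇔
  (λ (S , (sim , _) , xSy) →
    simulation⇒behaviourallyEquivalent T Λ mono expressive S sim x y xSy)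
  (behaviourallyEquivalent⇒bisimilar T Λ mono C D x y)
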